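{- Let $q$ be a prime power, $E=\mathbb{F}_q^n$, and let $M$ be a $q$-matroid on $E$ of rank $r$. Then the $q$-complex $\Delta_M$ associated to $M$ is shellable. In fact, if $F_1,\dots,F_t$ is an ordering of the facets of $\Delta_M$ such that $F_i\preccurlyeq F_j$ and $F_i\ne F_j$ for all $1\le i<j\le t$, then $F_1,\dots,F_t$ is a shelling of $\Delta_M$.
   Context: A $q$-matroid on $E$ is a pair $M=(E,\rho)$ with $\rho$ from the set of subspaces of $E$ to $\mathbb{N}$ satisfying $0\le\rho(A)\le\dim A$, $\rho(A)\le\rho(B)$ for $A\subseteq B$, and $\rho(A+B)+\rho(A\cap B)\le\rho(A)+\rho(B)$. Its rank is $\rho(E)$. A subspace $A$ is independent if $\rho(A)=\dim A$. $\Delta_M$ is the set of independent subspaces of $M$; it is a $q$-complex (a set of subspaces closed under taking subspaces), whose facets (inclusion-maximal members) are the bases of $M$, all of dimension $r$. For a set $\mathcal{A}$ of subspaces, $\langle\mathcal{A}\rangle$ is the set of all subspaces contained in some member of $\mathcal{A}$. A $q$-complex is shellable if it is pure (all facets of equal dimension) and its facets admit a shelling: a linear order $F_1,\dots,F_t$ such that for each $j\ge2$, $\langle F_j\rangle\cap\langle F_1,\dots,F_{j-1}\rangle$ is generated by a nonempty set of subspaces of $F_j$ of dimension $\dim F_j-1$. The order $\preccurlyeq$: fix a total order $\prec$ on $\mathbb{F}_q$ with $0\prec1\prec\alpha$ for all $\alpha\notin\{0,1\}$, extended lexicographically to $\mathbb{F}_q^n$; $\min S$ is the $\prec$-least element of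 $S$. For an $r$-dimensional subspace $U$, take a row echelon generator matrix with rows top to bottom $u_r,\dots,u_1$ and set $U_0=\{\mathbf 0\}$, $U_i=\langle u_1,\dots,u_i\rangle$, $\overline{U}_i=U_i\setminus U_{i-1}$ (these depend only on $U$). For $r$-dimensional $U,V$, $U\preccurlyeq V$ iff $U=V$ or there is $1\le e\le r$ with $U_j=V_j$ for $j<e$, $U_e\ne V_e$ and $\min\overline{U}_e\prec\min\overline{V}_e$; this is a total order on $r$-dimensional subspaces. -}

module Defs where

open import Level using (0ℓ)
open import Data.Nat as ℕ using (ℕ; zero; suc; _^_; _≤_; _∸_)
open import Data.Nat.Primality using (Prime)
open import Data.Fin as Fin using (Fin; toℕ)
open import Data.Vec as Vec using (Vec; []; _∷_; lookup; zipWith; replicate)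
open import Data.Bool using (Bool; true)
open import Data.Product using (Σ; ∃; ∃-syntax; _×_; _,_)
open import Data.Sum using (_⊎_)
open import Data.Empty using (⊥)
open import Relation.Nullary using (¬_)
open import Relation.Binary.PropositionalEquality using (_≡_; _≢_)
open import Algebra.Structures using (IsCommutativeRing)

IsPrimePower : ℕ → Set
IsPrimePower q = Σ ℕ λ p → Σ ℕ λ k → Prime p × (1 ≤ k) × (q ≡ p ^ k)

-- A finite field with q elements, realised on the carrier Fin q.
-- The fixed total order ≺ on F_q is the natural order of Fin q;
-- the requirement 0 ≺ 1 ≺ α (α ∉ {0,1}) is encoded by 0# ≡ 0 and 1# ≡ 1.

record FiniteField (q : ℕ) : Set where
  field
    _+F_  : Fin q → Fin q → Fin q
    _*F_  : Fin q → Fin q → Fin q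
    -F_   : Fin q → Fin q
    0F    : Fin q
    1F    : Fin q
    isCommutativeRing : IsCommutativeRing _≡_ _+F_ _*F_ -F_ 0F 1F
    0≢1   : 0F ≢ 1F
    inverse : ∀ x → x ≢ 0F → ∃[ y ] (x *F y ≡ 1F)

OrderedAsRequired : ∀ {q} → FiniteField q → Set
OrderedAsRequired {q} K = (toℕ (FiniteField.0F K) ≡ 0) × (toℕ (FiniteField.1F K) ≡ 1)

module LinAlg {q : ℕ} (K : FiniteField q) (n : ℕ) where
  open FiniteField K

  infix 4 _∈ₛ_ _⊆ₛ_ _≐_ _<lex_ _≤lex_
  infixl 6 _+v_
  infixr 7 _·v_

  Vect : Set
  Vect = Vec (Fin q) n

  0v : Vect
  0v = replicate n 0F

  _+v_ : Vect → Vect → Vect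
  _+v_ = zipWith _+F_

  _·v_ : Fin q → Vect → Vect
  c ·v v = Vec.map (c *F_) v

  lincomb : ∀ {k} → (Fin k → Fin q) → (Fin k → Vect) → Vect
  lincomb {zero}  c u = 0v
  lincomb {suc k} c u = (c Fin.zero ·v u Fin.zero) +v lincomb (λ i → c (Fin.suc i)) (λ i → u (Fin.suc i))

  InSpan : ∀ {k} → (Fin k → Vect) → Vect → Set
  InSpan {k} u v = ∃[ c ] (v ≡ lincomb {k} c u)

  LinIndep : ∀ {k} → (Fin k → Vect) → Set
  LinIndep {k} u = ∀ (c : Fin k → Fin q) → lincomb c u ≡ 0v → ∀ i → c i ≡ 0F

  record Subspace : Set where
    field
      mem   : Vect → Bool
      has0  : mem 0v ≡ true
      +-closed : ∀ u v → mem u ≡ true → mem v ≡ true → mem (u +v v) ≡ true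
      ·-closed : ∀ c v → mem v ≡ true → mem (c ·v v) ≡ true

  _∈ₛ_ : Vect → Subspace → Set
  v ∈ₛ U = Subspace.mem U v ≡ true

  Eₛ : Subspace
  Eₛ = record { mem = λ _ → true ; has0 = _≡_.refl
              ; +-closed = λ _ _ _ _ → _≡_.refl ; ·-closed = λ _ _ _ → _≡_.refl }

  _⊆ₛ_ : Subspace → Subspace → Set
  A ⊆ₛ B = ∀ v → v ∈ₛ A → v ∈ₛ B

  _≐_ : Subspace → Subspace → Set
  A ≐ B = ∀ v → Subspace.mem A v ≡ Subspace.mem B v

  IsSum : Subspace → Subspace → Subspace → Set
  IsSum S A B = ∀ v →
    (v ∈ₛ S → ∃[ a ] ∃[ b ] (a ∈ₛ A × b ∈ₛ B × v ≡ a +v b)) ×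
    (∃[ a ] ∃[ b ] (a ∈ₛ A × b ∈ₛ B × v ≡ a +v b) → v ∈ₛ S)

  IsIntersection : Subspace → Subspace → Subspace → Set
  IsIntersection I A B = ∀ v → (v ∈ₛ I → v ∈ₛ A × v ∈ₛ B) × (v ∈ₛ A × v ∈ₛ B → v ∈ₛ I)

  HasDim : Subspace → ℕ → Set
  HasDim A k = Σ (Fin k → Vect) λ u →
    LinIndep u × (∀ i → u i ∈ₛ A) × (∀ v → v ∈ₛ A → InSpan u v)

  record QMatroid : Set where
    field
      ρ : Subspace → ℕ
      ρ-resp : ∀ A B → A ≐ B → ρ A ≡ ρ B
      ρ-≤dim : ∀ A k → HasDim A k → ρ A ≤ k
      ρ-mono : ∀ A B → A ⊆ₛ B → ρ A ≤ ρ B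
      ρ-submod : ∀ A B S I → IsSum S A B → IsIntersection I A B →
                 ρ S ℕ.+ ρ I ≤ ρ A ℕ.+ ρ B

  rank : QMatroid → ℕ
  rank M = QMatroid.ρ M Eₛ

  Independent : QMatroid → Subspace → Set
  Independent M A = HasDim A (QMatroid.ρ M A)

  QComplex : Set₁
  QComplex = Subspace → Set

  IsQComplex : QComplex → Set
  IsQComplex Δ = ∀ A B → A ⊆ₛ B → Δ B → Δ A

  Δ : QMatroid → QComplex
  Δ M = Independent M

  IsFacet : QComplex → Subspace → Set
  IsFacet Δ' F = Δ' F × (∀ G → Δ' G → F ⊆ₛ G → G ≐ F)

  Pure : QComplex → Set
  Pure Δ' = ∃[ d ] (∀ F → IsFacet Δ' F → HasDim F d)

  IsFacetOrdering : QComplex → (t : ℕ) → (Fin t → Subspace) → Set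
  IsFacetOrdering Δ' t F =
    (∀ i → IsFacet Δ' (F i)) ×
    (∀ G → IsFacet Δ' G → ∃[ i ] (F i ≐ G)) ×
    (∀ i j → F i ≐ F j → i ≡ j)

  -- ⟨F_j⟩ ∩ ⟨F_1,…,F_{j-1}⟩ is generated by a nonempty (finite) set of
  -- subspaces of F_j of dimension dim F_j - 1
  ShellingStep : (t : ℕ) → (Fin t → Subspace) → Fin t → Set
  ShellingStep t F j =
    Σ ℕ λ m → Σ (Fin (suc m) → Subspace) λ 𝒢 →
      (∀ g → 𝒢 g ⊆ₛ F j × (∃[ k ] (HasDim (F j) (suc k) × HasDim (𝒢 g) k))) ×
      (∀ A → ((A ⊆ₛ F j × ∃[ i ] (toℕ i ℕ.< toℕ j × A ⊆ₛ F i)) → ∃[ g ] (A ⊆ₛ 𝒢 g)) ×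
             (∃[ g ] (A ⊆ₛ 𝒢 g) → (A ⊆ₛ F j × ∃[ i ] (toℕ i ℕ.< toℕ j × A ⊆ₛ F i))))

  IsShelling : QComplex → (t : ℕ) → (Fin t → Subspace) → Set
  IsShelling Δ' t F = IsFacetOrdering Δ' t F × (∀ j → 1 ≤ toℕ j → ShellingStep t F j)

  Shellable : QComplex → Set
  Shellable Δ' = Pure Δ' × ∃[ t ] ∃[ F ] IsShelling Δ' t F

  _<lex_ : ∀ {m} → Vec (Fin q) m → Vec (Fin q) m → Set
  []       <lex []       = ⊥
  (x ∷ xs) <lex (y ∷ ys) = (x Fin.< y) ⊎ ((x ≡ y) × (xs <lex ys))

  _≤lex_ : ∀ {m} → Vec (Fin q) m → Vec (Fin q) m → Set
  xs ≤lex ys = (xs ≡ ys) ⊎ (xs <lex ys)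

  Pivot : Vect → Fin n → Set
  Pivot v p = (lookup v p ≢ 0F) × (∀ i → i Fin.< p → lookup v i ≡ 0F)

  -- u : Fin r → Vect lists u_1,…,u_r (u_1 = bottom row); the generator
  -- matrix with rows u_r,…,u_1 (top to bottom) is in row echelon form
  IsEchelonGen : (r : ℕ) → Subspace → (Fin r → Vect) → Set
  IsEchelonGen r U u =
    (∀ i → u i ∈ₛ U) × (∀ v → v ∈ₛ U → InSpan u v) ×
    Σ (Fin r → Fin n) λ piv → (∀ i → Pivot (u i) (piv i)) ×
      (∀ i j → i Fin.< j → piv j Fin.< piv i)

  InU : ∀ {r} → (Fin r → Vect) → ℕ → Vect → Set
  InU {r} u i v = ∃[ c ] ((∀ k → i ≤ toℕ k → c k ≡ 0F) × v ≡ lincomb {r} c u)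

  -- v ∈ Ū_i = U_i ∖ U_{i-1}   (i ≥ 1)
  InUbar : ∀ {r} → (Fin r → Vect) → ℕ → Vect → Set
  InUbar u i v = InU u i v × ¬ InU u (i ∸ 1) v

  IsMinOf : (Vect → Set) → Vect → Set
  IsMinOf P x = P x × (∀ y → P y → x ≤lex y)

  SameSet : (Vect → Set) → (Vect → Set) → Set
  SameSet P Q = ∀ v → (P v → Q v) × (Q v → P v)

  Preceq : (r : ℕ) → Subspace → Subspace → Set
  Preceq r U V = (U ≐ V) ⊎
    (Σ (Fin r → Vect) λ u → Σ (Fin r → Vect) λ w →
       IsEchelonGen r U u × IsEchelonGen r V w ×
       Σ ℕ λ e → (1 ≤ e) × (e ≤ r) ×
         (∀ j → j ℕ.< e → SameSet (InU u j) (InU w j)) ×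
         ¬ SameSet (InU u e) (InU w e) ×
         ∃[ x ] ∃[ y ] (IsMinOf (InUbar u e) x × IsMinOf (InUbar w e) y × x <lex y))

{-# OPTIONS --safe #-}
module Submission where

-- For r-dimensional U, V the relation "U ≼ V and U ≠ V" says that the lex-least vector
-- of the symmetric difference of U and V lies in U: below min Ū_e both subspaces have
-- only the vectors of U_{e-1} = V_{e-1}.  Let U, V be bases, U before V, and let x be
-- that vector.  The subspace (U ∩ V) + ⟨x⟩ of U is independent, hence extends to a basis
-- W inside V + ⟨x⟩.  Then W ∩ V is a hyperplane of V containing U ∩ V.  Moreover
-- W is before V: W contains x ∉ V, while a vector of V below x lies in
-- U ∩ V and therefore in W.  So the hyperplanes W ∩ V generate the intersection of ⟨V⟩
-- with the complex of the earlier facets.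

open import Defs
open import Level using (0ℓ)
open import Algebra.Bundles using (CommutativeRing)
open import Algebra.Properties.CommutativeSemigroup using (interchange)
import Algebra.Properties.Ring as RingProperties
open import Data.Bool using (true; _∧_)
import Data.Bool.Properties as Bool
open import Data.Empty using (⊥; ⊥-elim)
open import Data.Fin using (Fin; zero; suc; _<_; toℕ; fromℕ<; inject; combine; finToFun; funToFin)
import Data.Fin.Properties as Fin
open import Data.List as List using (List; []; _∷_)
open import Data.List.Membership.Propositional using (_∈_)
open import Data.List.Membership.Propositional.Properties using (∈-allFin; ∈-cartesianProductWith⁺; ∈-lookup)
open import Data.List.Relation.Unary.All as All using (All; []; _∷_)
open import Data.List.Relation.Unary.AllPairs using (AllPairs; []; _∷_)
open import Data.List.Relation.Unary.Any as Any using (Any; here; there)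
import Data.List.Relation.Unary.Any.Properties as Any
open import Data.Nat as ℕ using (ℕ; zero; suc; _^_; _≤_; z≤n; s≤s)
import Data.Nat.Properties as ℕ
open import Data.Product using (∃; ∃-syntax; _×_; _,_; proj₁; proj₂)
open import Data.Sum using (_⊎_; inj₁; inj₂)
open import Data.Vec using (Vec; []; _∷_; lookup)
import Data.Vec.Properties as Vec
open import Data.Vec.Relation.Binary.Pointwise.Extensional using (ext; Pointwise-≡⇒≡)
open import Function using (_∘_; mk⇔)
open import Relation.Binary.Definitions using (tri<; tri≈; tri>)
open import Relation.Binary.PropositionalEquality using (_≡_; _≢_; refl; sym; trans; cong; cong₂; subst; module ≡-Reasoning)
open import Relation.Nullary using (¬_; Dec; yes; no; does; contradiction)
open import Relation.Nullary.Decidable using (dec-true; ¬?; _×-dec_; decidable-stable)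
open import Relation.Unary using (Decidable)

-- Boolean reflection and bounded search

private
  from-does : ∀ {P : Set} (P? : Dec P) → does P? ≡ true → P
  from-does (yes p) _ = p

  ∧-true : ∀ {a b} → a ∧ b ≡ true → a ≡ true × b ≡ true
  ∧-true {true} eq = refl , eq

findLeast : ∀ {n} {P : Fin n → Set} → Decidable P →
  (∀ i → ¬ P i) ⊎ ∃ λ i → P i × ∀ j → j < i → ¬ P j
findLeast {zero} P? = inj₁ λ ()
findLeast {suc n} P? with P? zero | findLeast (P? ∘ suc)
... | yes p | _ = inj₂ (zero , p , λ _ ())
... | no ¬p | inj₁ none = inj₁ λ { zero → ¬p ; (suc i) → none i }
... | no ¬p | inj₂ (i , p , least) =
  inj₂ (suc i , p , λ { zero _ → ¬p ; (suc j) (s≤s j<i) → least j j<i })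

findGreatest : ∀ {n} {P : Fin n → Set} → Decidable P →
  (∀ i → ¬ P i) ⊎ ∃ λ i → P i × ∀ j → i < j → ¬ P j
findGreatest {zero} P? = inj₁ λ ()
findGreatest {suc n} P? with findGreatest (P? ∘ suc) | P? zero
... | inj₂ (i , p , greatest) | _ = inj₂ (suc i , p , λ { (suc j) (s≤s i<j) → greatest j i<j })
... | inj₁ none | yes p = inj₂ (zero , p , λ { (suc j) _ → none j })
... | inj₁ none | no ¬p = inj₁ λ { zero → ¬p ; (suc i) → none i }

module _ {q : ℕ} (K : FiniteField q) (n : ℕ) where
  open FiniteField K
  open LinAlg K n
  open Subspace using (mem; has0; +-closed; ·-closed)

  -- Consequences of the field axioms

  private
    F-ring : CommutativeRing 0ℓ 0ℓ
    F-ring = record { isCommutativeRing = isCommutativeRing }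

    module R = CommutativeRing F-ring
    module RP = RingProperties R.ring

  q>1 : 1 ℕ.< q
  q>1 = bound 0F 1F 0≢1
    where
    bound : ∀ {m} (x y : Fin m) → x ≢ y → 1 ℕ.< m
    bound {suc zero} zero zero x≢y = contradiction refl x≢y
    bound {suc (suc m)} _ _ _ = s≤s (s≤s z≤n)

  *F-nonzero : ∀ {x y} → x ≢ 0F → y ≢ 0F → x *F y ≢ 0F
  *F-nonzero {x} {y} x≢0 y≢0 xy≡0 with inverse x x≢0
  ... | z , xz≡1 = y≢0 (begin
    y               ≡⟨ R.*-identityˡ y ⟨
    1F *F y         ≡⟨ cong (_*F y) (trans (R.*-comm z x) xz≡1) ⟨
    (z *F x) *F y   ≡⟨ R.*-assoc z x y ⟩
    z *F (x *F y)   ≡⟨ cong (z *F_) xy≡0 ⟩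
    z *F 0F         ≡⟨ R.zeroʳ z ⟩
    0F              ∎)
    where open ≡-Reasoning

  -- Vector arithmetic

  private
    at-+ : ∀ i u v → lookup (u +v v) i ≡ lookup u i +F lookup v i
    at-+ i u v = Vec.lookup-zipWith _+F_ i u v

    at-· : ∀ i c v → lookup (c ·v v) i ≡ c *F lookup v i
    at-· i c v = Vec.lookup-map i (c *F_) v

    at-0 : ∀ i → lookup 0v i ≡ 0F
    at-0 i = Vec.lookup-replicate i 0F

    vext : {u v : Vect} → (∀ i → lookup u i ≡ lookup v i) → u ≡ v
    vext eq = Pointwise-≡⇒≡ (ext eq)

  +v-assoc : ∀ u v w → (u +v v) +v w ≡ u +v (v +v w)
  +v-assoc = Vec.zipWith-assoc R.+-assoc

  +v-comm : ∀ u v → u +v v ≡ v +v u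
  +v-comm = Vec.zipWith-comm R.+-comm

  +v-identityˡ : ∀ v → 0v +v v ≡ v
  +v-identityˡ = Vec.zipWith-identityˡ R.+-identityˡ

  +v-identityʳ : ∀ v → v +v 0v ≡ v
  +v-identityʳ = Vec.zipWith-identityʳ R.+-identityʳ

  +v-interchange : ∀ s t u v → (s +v t) +v (u +v v) ≡ (s +v u) +v (t +v v)
  +v-interchange s t u v = vext λ i → begin
    lookup ((s +v t) +v (u +v v)) i
      ≡⟨ trans (at-+ i (s +v t) (u +v v)) (cong₂ _+F_ (at-+ i s t) (at-+ i u v)) ⟩
    (lookup s i +F lookup t i) +F (lookup u i +F lookup v i)
      ≡⟨ interchange R.+-commutativeSemigroup _ _ _ _ ⟩
    (lookup s i +F lookup u i) +F (lookup t i +F lookup v i)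
      ≡⟨ trans (at-+ i (s +v u) (t +v v)) (cong₂ _+F_ (at-+ i s u) (at-+ i t v)) ⟨
    lookup ((s +v u) +v (t +v v)) i ∎
    where open ≡-Reasoning

  ·v-distribˡ : ∀ c u v → c ·v (u +v v) ≡ c ·v u +v c ·v v
  ·v-distribˡ c u v = vext λ i → begin
    lookup (c ·v (u +v v)) i              ≡⟨ trans (at-· i c (u +v v)) (cong (c *F_) (at-+ i u v)) ⟩
    c *F (lookup u i +F lookup v i)       ≡⟨ R.distribˡ c _ _ ⟩
    (c *F lookup u i) +F (c *F lookup v i) ≡⟨ trans (at-+ i (c ·v u) (c ·v v)) (cong₂ _+F_ (at-· i c u) (at-· i c v)) ⟨
    lookup (c ·v u +v c ·v v) i           ∎
    where open ≡-Reasoning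

  ·v-distribʳ : ∀ v c d → (c +F d) ·v v ≡ c ·v v +v d ·v v
  ·v-distribʳ v c d = vext λ i → begin
    lookup ((c +F d) ·v v) i              ≡⟨ at-· i _ v ⟩
    (c +F d) *F lookup v i                ≡⟨ R.distribʳ _ c d ⟩
    (c *F lookup v i) +F (d *F lookup v i) ≡⟨ trans (at-+ i (c ·v v) (d ·v v)) (cong₂ _+F_ (at-· i c v) (at-· i d v)) ⟨
    lookup (c ·v v +v d ·v v) i           ∎
    where open ≡-Reasoning

  ·v-assoc : ∀ c d v → (c *F d) ·v v ≡ c ·v (d ·v v)
  ·v-assoc c d v = vext λ i → begin
    lookup ((c *F d) ·v v) i    ≡⟨ at-· i _ v ⟩
    (c *F d) *F lookup v i      ≡⟨ R.*-assoc c d _ ⟩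
    c *F (d *F lookup v i)      ≡⟨ trans (at-· i c (d ·v v)) (cong (c *F_) (at-· i d v)) ⟨
    lookup (c ·v (d ·v v)) i    ∎
    where open ≡-Reasoning

  ·v-identity : ∀ v → 1F ·v v ≡ v
  ·v-identity v = vext λ i → trans (at-· i 1F v) (R.*-identityˡ _)

  ·v-zeroˡ : ∀ v → 0F ·v v ≡ 0v
  ·v-zeroˡ v = vext λ i → trans (at-· i 0F v) (trans (R.zeroˡ _) (sym (at-0 i)))

  ·v-zeroʳ : ∀ c → c ·v 0v ≡ 0v
  ·v-zeroʳ c = vext λ i →
    trans (at-· i c 0v) (trans (cong (c *F_) (at-0 i)) (trans (R.zeroʳ c) (sym (at-0 i))))

  +v-cancel : ∀ v c b → (v +v c ·v b) +v (-F c) ·v b ≡ v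
  +v-cancel v c b = begin
    (v +v c ·v b) +v (-F c) ·v b    ≡⟨ +v-assoc v _ _ ⟩
    v +v (c ·v b +v (-F c) ·v b)    ≡⟨ cong (v +v_) (·v-distribʳ b c (-F c)) ⟨
    v +v (c +F (-F c)) ·v b         ≡⟨ cong (λ d → v +v d ·v b) (R.-‿inverseʳ c) ⟩
    v +v 0F ·v b                    ≡⟨ cong (v +v_) (·v-zeroˡ b) ⟩
    v +v 0v                         ≡⟨ +v-identityʳ v ⟩
    v                               ∎
    where open ≡-Reasoning

  +v-inverse : ∀ v → v +v (-F 1F) ·v v ≡ 0v
  +v-inverse v = begin
    v +v (-F 1F) ·v v               ≡⟨ cong (_+v (-F 1F) ·v v) (trans (+v-identityˡ _) (·v-identity v)) ⟨
    (0v +v 1F ·v v) +v (-F 1F) ·v v ≡⟨ +v-cancel 0v 1F v ⟩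
    0v                              ∎
    where open ≡-Reasoning

  -- Linear combinations

  lincomb-cong : ∀ {k} {c d : Fin k → Fin q} (u : Fin k → Vect) →
    (∀ i → c i ≡ d i) → lincomb c u ≡ lincomb d u
  lincomb-cong {zero} u eq = refl
  lincomb-cong {suc k} u eq =
    cong₂ _+v_ (cong (_·v u zero) (eq zero)) (lincomb-cong (u ∘ suc) (eq ∘ suc))

  lincomb-+ : ∀ {k} (c d : Fin k → Fin q) (u : Fin k → Vect) →
    lincomb (λ i → c i +F d i) u ≡ lincomb c u +v lincomb d u
  lincomb-+ {zero} c d u = sym (+v-identityˡ 0v)
  lincomb-+ {suc k} c d u =
    trans (cong₂ _+v_ (·v-distribʳ (u zero) _ _) (lincomb-+ (c ∘ suc) (d ∘ suc) (u ∘ suc)))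
          (+v-interchange _ _ _ _)

  lincomb-· : ∀ {k} a (c : Fin k → Fin q) (u : Fin k → Vect) →
    lincomb (λ i → a *F c i) u ≡ a ·v lincomb c u
  lincomb-· {zero} a c u = sym (·v-zeroʳ a)
  lincomb-· {suc k} a c u =
    trans (cong₂ _+v_ (·v-assoc a _ _) (lincomb-· a (c ∘ suc) (u ∘ suc)))
          (sym (·v-distribˡ a _ _))

  lincomb-∈ : ∀ {k} (A : Subspace) (c : Fin k → Fin q) (u : Fin k → Vect) →
    (∀ i → u i ∈ₛ A) → lincomb c u ∈ₛ A
  lincomb-∈ {zero} A c u u∈A = has0 A
  lincomb-∈ {suc k} A c u u∈A =
    +-closed A _ _ (·-closed A _ _ (u∈A zero)) (lincomb-∈ A (c ∘ suc) (u ∘ suc) (u∈A ∘ suc))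

  LinIndep⇒injective : ∀ {k} {u : Fin k → Vect} → LinIndep u →
    ∀ {c d} → lincomb c u ≡ lincomb d u → ∀ i → c i ≡ d i
  LinIndep⇒injective {u = u} indep {c} {d} eq i = begin
    c i             ≡⟨ RP.+-inverseˡ-unique _ _ (indep e e≡0 i) ⟩
    -F ((-F 1F) *F d i)  ≡⟨ cong -F_ (RP.-1*x≈-x (d i)) ⟩
    -F (-F (d i))     ≡⟨ RP.-‿involutive (d i) ⟩
    d i             ∎
    where
    open ≡-Reasoning
    e : Fin _ → Fin q
    e j = c j +F ((-F 1F) *F d j)
    e≡0 : lincomb e u ≡ 0v
    e≡0 = begin
      lincomb e u                              ≡⟨ lincomb-+ c _ u ⟩
      lincomb c u +v lincomb (λ j → (-F 1F) *F d j) u ≡⟨ cong₂ _+v_ eq (lincomb-· (-F 1F) d u) ⟩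
      lincomb d u +v (-F 1F) ·v lincomb d u    ≡⟨ +v-inverse _ ⟩
      0v                                       ∎

  -- Dimension

  -- Pigeonhole on coefficient families: there are `q ^ k` and `q ^ m` of them, and `q>1` lets the
  -- exponents be compared. This counting takes the place of the Steinitz exchange lemma.
  -- Injectivity is pointwise because families are functions.
  injection⇒≤ : ∀ {k m} (f : (Fin k → Fin q) → (Fin m → Fin q)) →
    (∀ {c d} → (∀ i → f c i ≡ f d i) → ∀ i → c i ≡ d i) → k ≤ m
  injection⇒≤ {k} {m} f inj = ℕ.≮⇒≥ λ m<k →
    ℕ.<⇒≱ (ℕ.^-monoʳ-< q q>1 m<k) (Fin.injective⇒≤ {f = g} g-injective)
    where
    open ≡-Reasoning
    g : Fin (q ^ k) → Fin (q ^ m)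
    g i = funToFin (f (finToFun i))

    funToFin-cong : ∀ {k} {c d : Fin k → Fin q} → (∀ i → c i ≡ d i) → funToFin c ≡ funToFin d
    funToFin-cong {zero} eq = refl
    funToFin-cong {suc k} eq = cong₂ combine (eq zero) (funToFin-cong (eq ∘ suc))

    g-injective : ∀ {x y} → g x ≡ g y → x ≡ y
    g-injective {x} {y} eq = begin
      x                          ≡⟨ Fin.funToFin-finToFin {k} {q} x ⟨
      funToFin (finToFun {q} {k} x)  ≡⟨ funToFin-cong (inj λ i → trans (sym (Fin.finToFun-funToFin (f (finToFun x)) i))
                                      (trans (cong (λ z → finToFun z i) eq) (Fin.finToFun-funToFin (f (finToFun y)) i))) ⟩
      funToFin (finToFun {q} {k} y)  ≡⟨ Fin.funToFin-finToFin {k} {q} y ⟩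
      y                          ∎

  HasDim⇒≤n : ∀ A {k} → HasDim A k → k ≤ n
  HasDim⇒≤n A (u , indep , _) =
    injection⇒≤ (λ c → lookup (lincomb c u)) λ eq → LinIndep⇒injective indep (vext eq)

  -- Coordinates over the spanning family `w` determine a combination of the independent family `u`,
  -- hence its coefficients.
  HasDim-mono : ∀ A B {k m} → A ⊆ₛ B → HasDim A k → HasDim B m → k ≤ m
  HasDim-mono A B A⊆B (u , indep , u∈A , _) (w , _ , _ , spans) =
    injection⇒≤ (λ c → proj₁ (coords c)) λ {c} {d} eq →
      LinIndep⇒injective indep (trans (proj₂ (coords c)) (trans (lincomb-cong w eq) (sym (proj₂ (coords d)))))
    where
    coords : ∀ c → InSpan w (lincomb c u)
    coords c = spans _ (A⊆B _ (lincomb-∈ A c u u∈A))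

  HasDim-unique : ∀ A {k m} → HasDim A k → HasDim A m → k ≡ m
  HasDim-unique A dk dm =
    ℕ.≤-antisym (HasDim-mono A A (λ _ z → z) dk dm) (HasDim-mono A A (λ _ z → z) dm dk)

  HasDim-resp : ∀ A B {k} → A ≐ B → HasDim A k → HasDim B k
  HasDim-resp A B A≐B (u , indep , u∈A , spans) =
    u , indep , (λ i → trans (sym (A≐B _)) (u∈A i)) , λ v v∈B → spans v (trans (A≐B v) v∈B)

  -- Operations on subspaces

  ≐-sym : ∀ A B → A ≐ B → B ≐ A
  ≐-sym A B A≐B v = sym (A≐B v)

  ≐⇒⊆ : ∀ A B → A ≐ B → A ⊆ₛ B
  ≐⇒⊆ A B A≐B v v∈A = trans (sym (A≐B v)) v∈A

  ⊆-antisym : ∀ A B → A ⊆ₛ B → B ⊆ₛ A → A ≐ B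
  ⊆-antisym A B A⊆B B⊆A v = Bool.⇔→≡ (mk⇔ (A⊆B v) (B⊆A v))

  _∈?_ : ∀ v A → Dec (v ∈ₛ A)
  v ∈? A = mem A v Bool.≟ true

  infixl 7 _∩ₛ_
  _∩ₛ_ : Subspace → Subspace → Subspace
  A ∩ₛ B = record
    { mem = λ v → mem A v ∧ mem B v
    ; has0 = cong₂ _∧_ (has0 A) (has0 B)
    ; +-closed = λ u v u∈ v∈ → cong₂ _∧_
        (+-closed A u v (proj₁ (∧-true u∈)) (proj₁ (∧-true v∈)))
        (+-closed B u v (proj₂ (∧-true {mem A u} u∈)) (proj₂ (∧-true {mem A v} v∈)))
    ; ·-closed = λ c v v∈ → cong₂ _∧_
        (·-closed A c v (proj₁ (∧-true v∈))) (·-closed B c v (proj₂ (∧-true {mem A v} v∈)))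
    }

  ∈-∩⁺ : ∀ A B {v} → v ∈ₛ A → v ∈ₛ B → v ∈ₛ A ∩ₛ B
  ∈-∩⁺ A B v∈A v∈B = cong₂ _∧_ v∈A v∈B

  ∩⊆ˡ : ∀ A B → A ∩ₛ B ⊆ₛ A
  ∩⊆ˡ A B v v∈ = proj₁ (∧-true v∈)

  ∩⊆ʳ : ∀ A B → A ∩ₛ B ⊆ₛ B
  ∩⊆ʳ A B v v∈ = proj₂ (∧-true {mem A v} v∈)

  ∩-isIntersection : ∀ A B → IsIntersection (A ∩ₛ B) A B
  ∩-isIntersection A B v =
    (λ v∈ → ∩⊆ˡ A B v v∈ , ∩⊆ʳ A B v v∈) , λ (v∈A , v∈B) → ∈-∩⁺ A B v∈A v∈B

  0ₛ : Subspace
  0ₛ = record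
    { mem = λ v → does (v ≟0)
    ; has0 = dec-true (0v ≟0) refl
    ; +-closed = λ u v u∈ v∈ → dec-true ((u +v v) ≟0)
        (trans (cong₂ _+v_ (from-does (u ≟0) u∈) (from-does (v ≟0) v∈)) (+v-identityˡ 0v))
    ; ·-closed = λ c v v∈ → dec-true ((c ·v v) ≟0)
        (trans (cong (c ·v_) (from-does (v ≟0) v∈)) (·v-zeroʳ c))
    }
    where
    _≟0 : ∀ v → Dec (v ≡ 0v)
    v ≟0 = Vec.≡-dec Fin._≟_ v 0v

  ∈-0⇒≡ : ∀ {v} → v ∈ₛ 0ₛ → v ≡ 0v
  ∈-0⇒≡ {v} = from-does (Vec.≡-dec Fin._≟_ v 0v)

  0⊆ : ∀ A → 0ₛ ⊆ₛ A
  0⊆ A v v∈0 = subst (_∈ₛ A) (sym (∈-0⇒≡ v∈0)) (has0 A)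

  HasDim-0 : HasDim 0ₛ 0
  HasDim-0 = (λ ()) , (λ _ _ ()) , (λ ()) , λ v v∈0 → (λ ()) , ∈-0⇒≡ v∈0

  abstract
    -- This is `A` plus the span of `b`. Membership is decided by trying every scalar `c`, and
    -- `abstract` keeps that search from unfolding.
    adjoin : Subspace → Vect → Subspace
    adjoin A b = record
      { mem = λ v → does (inAdj v)
      ; has0 = dec-true (inAdj 0v) (0F , subst (_∈ₛ A) (sym (absorb 0v)) (has0 A))
      ; +-closed = λ u v u∈ v∈ → dec-true (inAdj (u +v v)) (add u v (from-does (inAdj u) u∈) (from-does (inAdj v) v∈))
      ; ·-closed = λ c v v∈ → dec-true (inAdj (c ·v v)) (scale c v (from-does (inAdj v) v∈))
      }
      where
      inAdj : ∀ v → Dec (∃ λ c → v +v c ·v b ∈ₛ A)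
      inAdj v = Fin.any? λ c → (v +v c ·v b) ∈? A

      absorb : ∀ v → v +v 0F ·v b ≡ v
      absorb v = trans (cong (v +v_) (·v-zeroˡ b)) (+v-identityʳ v)

      add : ∀ u v → ∃ (λ c → u +v c ·v b ∈ₛ A) → ∃ (λ c → v +v c ·v b ∈ₛ A) →
        ∃ λ c → (u +v v) +v c ·v b ∈ₛ A
      add u v (c , u∈) (d , v∈) = c +F d , subst (_∈ₛ A)
        (trans (+v-interchange u _ v _) (cong ((u +v v) +v_) (sym (·v-distribʳ b c d))))
        (+-closed A _ _ u∈ v∈)

      scale : ∀ a v → ∃ (λ c → v +v c ·v b ∈ₛ A) → ∃ λ c → a ·v v +v c ·v b ∈ₛ A
      scale a v (c , v∈) = a *F c , subst (_∈ₛ A)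
        (trans (·v-distribˡ a v _) (cong (a ·v v +v_) (sym (·v-assoc a c b))))
        (·-closed A a _ v∈)

    ∈-adjoin⁻ : ∀ A b {v} → v ∈ₛ adjoin A b → ∃ λ c → v +v c ·v b ∈ₛ A
    ∈-adjoin⁻ A b {v} = from-does (Fin.any? λ c → (v +v c ·v b) ∈? A)

    ∈-adjoin⁺ : ∀ A b {v} c → v +v c ·v b ∈ₛ A → v ∈ₛ adjoin A b
    ∈-adjoin⁺ A b {v} c v∈ = dec-true (Fin.any? λ c → (v +v c ·v b) ∈? A) (c , v∈)

  ⊆-adjoin : ∀ A b → A ⊆ₛ adjoin A b
  ⊆-adjoin A b v v∈A = ∈-adjoin⁺ A b 0F
    (subst (_∈ₛ A) (sym (trans (cong (v +v_) (·v-zeroˡ b)) (+v-identityʳ v))) v∈A)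

  ∈-adjoin : ∀ A b → b ∈ₛ adjoin A b
  ∈-adjoin A b = ∈-adjoin⁺ A b (-F 1F) (subst (_∈ₛ A) (sym (+v-inverse b)) (has0 A))

  adjoin-⊆ : ∀ A B b → A ⊆ₛ B → b ∈ₛ B → adjoin A b ⊆ₛ B
  adjoin-⊆ A B b A⊆B b∈B v v∈ with ∈-adjoin⁻ A b v∈
  ... | c , v+cb∈A = subst (_∈ₛ B) (+v-cancel v c b)
    (+-closed B _ _ (A⊆B _ v+cb∈A) (·-closed B _ b b∈B))

  adjoin-mono : ∀ A B b → A ⊆ₛ B → adjoin A b ⊆ₛ adjoin B b
  adjoin-mono A B b A⊆B = adjoin-⊆ A (adjoin B b) b
    (λ v v∈A → ⊆-adjoin B b v (A⊆B v v∈A)) (∈-adjoin B b)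

  adjoin-cong : ∀ A B b → A ≐ B → adjoin A b ≐ adjoin B b
  adjoin-cong A B b A≐B = ⊆-antisym (adjoin A b) (adjoin B b)
    (adjoin-mono A B b (≐⇒⊆ A B A≐B)) (adjoin-mono B A b (≐⇒⊆ B A (≐-sym A B A≐B)))

  -- The second summand is `adjoin A b` rather than the span of `b`, so that in submodularity its
  -- intersection with `C` still contains `A`.
  adjoin-isSum : ∀ A C b → A ⊆ₛ C → IsSum (adjoin C b) C (adjoin A b)
  adjoin-isSum A C b A⊆C v = split , λ (x , y , x∈C , y∈ , v≡) →
    subst (_∈ₛ adjoin C b) (sym v≡)
      (+-closed (adjoin C b) x y (⊆-adjoin C b x x∈C) (adjoin-mono A C b A⊆C y y∈))
    where
    split : v ∈ₛ adjoin C b → ∃[ x ] ∃[ y ] (x ∈ₛ C × y ∈ₛ adjoin A b × v ≡ x +v y)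
    split v∈ with ∈-adjoin⁻ C b v∈
    ... | c , v+cb∈C = v +v c ·v b , (-F c) ·v b , v+cb∈C
      , ·-closed (adjoin A b) _ b (∈-adjoin A b) , sym (+v-cancel v c b)

  -- If `b` had a nonzero coefficient in a vanishing combination, dividing by it would put `b` into
  -- `A`.
  HasDim-adjoin : ∀ A b {k} → ¬ b ∈ₛ A → HasDim A k → HasDim (adjoin A b) (suc k)
  HasDim-adjoin A b {k} b∉A (u , indep , u∈A , spans) =
    u⁺ , indep⁺ , (λ { zero → ∈-adjoin A b ; (suc i) → ⊆-adjoin A b _ (u∈A i) }) , spans⁺
    where
    open ≡-Reasoning
    u⁺ : Fin (suc k) → Vect
    u⁺ zero = b
    u⁺ (suc i) = u i

    coeff≡0 : ∀ a w → w ∈ₛ A → a ·v b +v w ≡ 0v → a ≡ 0F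
    coeff≡0 a w w∈A eq with a Fin.≟ 0F
    ... | yes a≡0 = a≡0
    ... | no a≢0 with inverse a a≢0
    ... | z , az≡1 = contradiction (subst (_∈ₛ A) b≡ (·-closed A _ _ (·-closed A _ _ w∈A))) b∉A
      where
      ab≡ : a ·v b ≡ (-F 1F) ·v w
      ab≡ = begin
        a ·v b                                ≡⟨ +v-cancel _ 1F w ⟨
        (a ·v b +v 1F ·v w) +v (-F 1F) ·v w   ≡⟨ cong (λ y → (a ·v b +v y) +v (-F 1F) ·v w) (·v-identity w) ⟩
        (a ·v b +v w) +v (-F 1F) ·v w         ≡⟨ cong (_+v (-F 1F) ·v w) eq ⟩
        0v +v (-F 1F) ·v w                    ≡⟨ +v-identityˡ _ ⟩
        (-F 1F) ·v w                          ∎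
      b≡ : z ·v ((-F 1F) ·v w) ≡ b
      b≡ = begin
        z ·v ((-F 1F) ·v w)   ≡⟨ cong (z ·v_) ab≡ ⟨
        z ·v (a ·v b)         ≡⟨ ·v-assoc z a b ⟨
        (z *F a) ·v b         ≡⟨ cong (_·v b) (trans (R.*-comm z a) az≡1) ⟩
        1F ·v b               ≡⟨ ·v-identity b ⟩
        b                     ∎

    indep⁺ : LinIndep u⁺
    indep⁺ c eq = λ { zero → c₀≡0 ; (suc i) → indep (c ∘ suc) rest≡0 i }
      where
      c₀≡0 : c zero ≡ 0F
      c₀≡0 = coeff≡0 _ _ (lincomb-∈ A (c ∘ suc) u u∈A) eq
      rest≡0 : lincomb (c ∘ suc) u ≡ 0v
      rest≡0 = begin
        lincomb (c ∘ suc) u                   ≡⟨ +v-identityˡ _ ⟨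
        0v +v lincomb (c ∘ suc) u             ≡⟨ cong (_+v _) (·v-zeroˡ b) ⟨
        0F ·v b +v lincomb (c ∘ suc) u        ≡⟨ cong (λ a → a ·v b +v lincomb (c ∘ suc) u) c₀≡0 ⟨
        c zero ·v b +v lincomb (c ∘ suc) u    ≡⟨ eq ⟩
        0v                                    ∎

    spans⁺ : ∀ v → v ∈ₛ adjoin A b → InSpan u⁺ v
    spans⁺ v v∈ with ∈-adjoin⁻ A b v∈
    ... | a , v+ab∈A with spans _ v+ab∈A
    ... | c , eq = (λ { zero → -F a ; (suc i) → c i }) , (begin
      v                                ≡⟨ +v-cancel v a b ⟨
      (v +v a ·v b) +v (-F a) ·v b     ≡⟨ +v-comm _ _ ⟩
      (-F a) ·v b +v (v +v a ·v b)     ≡⟨ cong ((-F a) ·v b +v_) eq ⟩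
      (-F a) ·v b +v lincomb c u       ∎)

  -- The order on subspaces

  <lex-irrefl : ∀ {m} (x : Vec (Fin q) m) → ¬ x <lex x
  <lex-irrefl (a ∷ x) (inj₁ a<a) = Fin.<-irrefl refl a<a
  <lex-irrefl (a ∷ x) (inj₂ (_ , x<x)) = <lex-irrefl x x<x

  <lex-trans : ∀ {m} (x y z : Vec (Fin q) m) → x <lex y → y <lex z → x <lex z
  <lex-trans [] [] [] () _
  <lex-trans (a ∷ x) (b ∷ y) (c ∷ z) (inj₁ a<b) (inj₁ b<c) = inj₁ (Fin.<-trans a<b b<c)
  <lex-trans (a ∷ x) (b ∷ y) (c ∷ z) (inj₁ a<b) (inj₂ (refl , _)) = inj₁ a<b
  <lex-trans (a ∷ x) (b ∷ y) (c ∷ z) (inj₂ (refl , _)) (inj₁ b<c) = inj₁ b<c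
  <lex-trans (a ∷ x) (b ∷ y) (c ∷ z) (inj₂ (refl , x<y)) (inj₂ (refl , y<z)) =
    inj₂ (refl , <lex-trans x y z x<y y<z)

  <lex-connex : ∀ {m} (x y : Vec (Fin q) m) → x <lex y ⊎ x ≡ y ⊎ y <lex x
  <lex-connex [] [] = inj₂ (inj₁ refl)
  <lex-connex (a ∷ x) (b ∷ y) with Fin.<-cmp a b | <lex-connex x y
  ... | tri< a<b _ _ | _ = inj₁ (inj₁ a<b)
  ... | tri> _ _ b<a | _ = inj₂ (inj₂ (inj₁ b<a))
  ... | tri≈ _ refl _ | inj₁ x<y = inj₁ (inj₂ (refl , x<y))
  ... | tri≈ _ refl _ | inj₂ (inj₁ refl) = inj₂ (inj₁ refl)
  ... | tri≈ _ refl _ | inj₂ (inj₂ y<x) = inj₂ (inj₂ (inj₂ (refl , y<x)))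

  -- Proceeds by coordinates: the least head that has a suitable tail, then the least suitable tail
  -- for it. It also serves to decide whether a suitable vector exists at all.
  findLeastLex : ∀ {m} {P : Vec (Fin q) m → Set} → Decidable P →
    (∀ v → ¬ P v) ⊎ ∃ λ v → P v × ∀ w → w <lex v → ¬ P w
  findLeastLex {zero} P? with P? []
  ... | yes p = inj₂ ([] , p , λ { [] () })
  ... | no ¬p = inj₁ λ { [] → ¬p }
  findLeastLex {suc m} {P} P? with findLeast someTail?
    where
    someTail? : Decidable λ a → ∃ λ v → P (a ∷ v)
    someTail? a with findLeastLex (P? ∘ (a ∷_))
    ... | inj₁ none = no λ (v , p) → none v p
    ... | inj₂ (v , p , _) = yes (v , p)
  ... | inj₁ none = inj₁ λ { (a ∷ v) p → none a (v , p) }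
  ... | inj₂ (a , (v₀ , p₀) , a-least) with findLeastLex (P? ∘ (a ∷_))
  ... | inj₁ none = contradiction p₀ (none v₀)
  ... | inj₂ (v , p , v-least) = inj₂ (a ∷ v , p , λ
    { (b ∷ w) (inj₁ b<a) pw → a-least b b<a (w , pw)
    ; (b ∷ w) (inj₂ (refl , w<v)) pw → v-least w w<v pw })

  infix 4 _≺_
  -- Lexicographic comparison of the membership functions, with membership ranked first. No echelon
  -- basis occurs, so the order laws and the exchange argument become direct.
  _≺_ : Subspace → Subspace → Set
  U ≺ V = ∃ λ x → x ∈ₛ U × ¬ x ∈ₛ V × ∀ v → v <lex x → mem U v ≡ mem V v

  ≺-irrefl : ∀ U V → U ≐ V → ¬ U ≺ V
  ≺-irrefl U V U≐V (x , x∈U , x∉V , _) = x∉V (≐⇒⊆ U V U≐V x x∈U)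

  -- The smaller of the two witnesses works; they cannot coincide, since one lies outside `V` and
  -- the other inside.
  ≺-trans : ∀ U V W → U ≺ V → V ≺ W → U ≺ W
  ≺-trans U V W (x , x∈U , x∉V , x-min) (y , y∈V , y∉W , y-min) with <lex-connex x y
  ... | inj₁ x<y = x , x∈U , (λ x∈W → x∉V (trans (y-min x x<y) x∈W))
    , λ v v<x → trans (x-min v v<x) (y-min v (<lex-trans v x y v<x x<y))
  ... | inj₂ (inj₁ refl) = contradiction y∈V x∉V
  ... | inj₂ (inj₂ y<x) = y , trans (x-min y y<x) y∈V , y∉W
    , λ v v<y → trans (x-min v (<lex-trans v y x v<y y<x)) (y-min v v<y)

  -- The least vector on which membership differs, if there is one, decides.
  ≺-connex : ∀ U V → U ≺ V ⊎ U ≐ V ⊎ V ≺ U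
  ≺-connex U V with findLeastLex (λ v → ¬? (mem U v Bool.≟ mem V v))
  ... | inj₁ agree = inj₂ (inj₁ λ v → decidable-stable (mem U v Bool.≟ mem V v) (agree v))
  ... | inj₂ (x , differ , x-least) with x ∈? U | x ∈? V
  ... | yes x∈U | yes x∈V = contradiction (trans x∈U (sym x∈V)) differ
  ... | yes x∈U | no x∉V = inj₁ (x , x∈U , x∉V , below)
    where
    below : ∀ v → v <lex x → mem U v ≡ mem V v
    below v v<x = decidable-stable (mem U v Bool.≟ mem V v) (x-least v v<x)
  ... | no x∉U | yes x∈V = inj₂ (inj₂ (x , x∈V , x∉U , below))
    where
    below : ∀ v → v <lex x → mem V v ≡ mem U v
    below v v<x = sym (decidable-stable (mem U v Bool.≟ mem V v) (x-least v v<x))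
  ... | no x∉U | no x∉V =
    contradiction (trans (Bool.¬-not x∉U) (sym (Bool.¬-not x∉V))) differ

  -- Comparison of ≺ with the echelon order ≼

  lookup-lincomb-zero : ∀ {k} (c : Fin k → Fin q) (u : Fin k → Vect) p →
    (∀ i → c i *F lookup (u i) p ≡ 0F) → lookup (lincomb c u) p ≡ 0F
  lookup-lincomb-zero {zero} c u p _ = at-0 p
  lookup-lincomb-zero {suc k} c u p vanish = begin
    lookup (lincomb c u) p
      ≡⟨ at-+ p (c zero ·v u zero) (lincomb (c ∘ suc) (u ∘ suc)) ⟩
    lookup (c zero ·v u zero) p +F lookup (lincomb (c ∘ suc) (u ∘ suc)) p
      ≡⟨ cong₂ _+F_ (trans (at-· p _ (u zero)) (vanish zero))
                    (lookup-lincomb-zero (c ∘ suc) (u ∘ suc) p (vanish ∘ suc)) ⟩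
    0F +F 0F
      ≡⟨ R.+-identityˡ 0F ⟩
    0F ∎
    where open ≡-Reasoning

  lookup-lincomb-single : ∀ {k} (c : Fin k → Fin q) (u : Fin k → Vect) p j →
    (∀ i → i ≢ j → c i *F lookup (u i) p ≡ 0F) →
    lookup (lincomb c u) p ≡ c j *F lookup (u j) p
  lookup-lincomb-single {suc k} c u p zero vanish = begin
    lookup (lincomb c u) p
      ≡⟨ at-+ p (c zero ·v u zero) (lincomb (c ∘ suc) (u ∘ suc)) ⟩
    lookup (c zero ·v u zero) p +F lookup (lincomb (c ∘ suc) (u ∘ suc)) p
      ≡⟨ cong₂ _+F_ (at-· p _ (u zero))
                    (lookup-lincomb-zero (c ∘ suc) (u ∘ suc) p (λ i → vanish (suc i) λ ())) ⟩
    (c zero *F lookup (u zero) p) +F 0F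
      ≡⟨ R.+-identityʳ _ ⟩
    c zero *F lookup (u zero) p ∎
    where open ≡-Reasoning
  lookup-lincomb-single {suc k} c u p (suc j) vanish = begin
    lookup (lincomb c u) p
      ≡⟨ at-+ p (c zero ·v u zero) (lincomb (c ∘ suc) (u ∘ suc)) ⟩
    lookup (c zero ·v u zero) p +F lookup (lincomb (c ∘ suc) (u ∘ suc)) p
      ≡⟨ cong₂ _+F_ (trans (at-· p _ (u zero)) (vanish zero λ ()))
                    (lookup-lincomb-single (c ∘ suc) (u ∘ suc) p j
                      (λ i i≢j → vanish (suc i) (i≢j ∘ Fin.suc-injective))) ⟩
    0F +F (c (suc j) *F lookup (u (suc j)) p)
      ≡⟨ R.+-identityˡ _ ⟩
    c (suc j) *F lookup (u (suc j)) p ∎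
    where open ≡-Reasoning

  module EchelonOrder (0F-least : toℕ 0F ≡ 0) where

    0F<nonzero : ∀ {a} → a ≢ 0F → 0F < a
    0F<nonzero {a} a≢0 = subst (ℕ._< toℕ a) (sym 0F-least)
      (ℕ.n≢0⇒n>0 λ a≡0 → a≢0 (Fin.toℕ-injective (trans a≡0 (sym 0F-least))))

    -- The first nonzero entry of `v` stands at `p` or earlier, where `x` still has `0F`, the least
    -- scalar.
    zeros⇒<lex : ∀ {m} (x v : Vec (Fin q) m) p →
      (∀ i → toℕ i ≤ toℕ p → lookup x i ≡ 0F) → lookup v p ≢ 0F → x <lex v
    zeros⇒<lex (a ∷ x) (b ∷ v) zero zeros b≢0 =
      inj₁ (subst (_< b) (sym (zeros zero z≤n)) (0F<nonzero b≢0))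
    zeros⇒<lex (a ∷ x) (b ∷ v) (suc p) zeros v≢0 with b Fin.≟ 0F
    ... | no b≢0 = inj₁ (subst (_< b) (sym (zeros zero z≤n)) (0F<nonzero b≢0))
    ... | yes refl = inj₂ (zeros zero z≤n , zeros⇒<lex x v p (λ i i≤p → zeros (suc i) (s≤s i≤p)) v≢0)

    -- Vectors outside U_e have an earlier leading position than those in U_e, so
    -- min (U_e ∖ U_{e-1}) is in fact the minimum of U ∖ U_{e-1}.
    below-min⇒InU : ∀ {r} U (u : Fin r → Vect) e x v → IsEchelonGen r U u →
      IsMinOf (InUbar u (suc e)) x → v ∈ₛ U → v <lex x → InU u e v
    below-min⇒InU U u e x v (_ , spans , piv , pivot , decr) (((d , d-zero , x≡) , _) , x-min) v∈U v<x
      with spans v v∈U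
    -- If some row outside U_e occurs in `v`, then `k` is the topmost such row, and its pivot is the
    -- leading position of `v`.
    ... | c , v≡ with findGreatest (λ k → (e ℕ.≤? toℕ k) ×-dec ¬? (c k Fin.≟ 0F))
    ... | inj₁ none =
      c , (λ k e≤k → decidable-stable (c k Fin.≟ 0F) (λ c≢0 → none k (e≤k , c≢0))) , v≡
    ... | inj₂ (k , (e≤k , ck≢0) , k-greatest) = ⊥-elim absurd
      where
      c-zero : ∀ j → k < j → c j ≡ 0F
      c-zero j k<j = decidable-stable (c j Fin.≟ 0F)
        (λ c≢0 → k-greatest j k<j (ℕ.≤-trans e≤k (ℕ.<⇒≤ k<j) , c≢0))

      before-pivot : ∀ j → j < k → ∀ p → toℕ p ≤ toℕ (piv k) → lookup (u j) p ≡ 0F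
      before-pivot j j<k p p≤ = proj₂ (pivot j) p (ℕ.≤-<-trans p≤ (decr j k j<k))

      vanishing : ∀ a → (∀ j → toℕ k ≤ toℕ j → a j ≡ 0F) →
        ∀ p → toℕ p ≤ toℕ (piv k) → lookup (lincomb a u) p ≡ 0F
      vanishing a a-zero p p≤ = lookup-lincomb-zero a u p term
        where
        term : ∀ j → a j *F lookup (u j) p ≡ 0F
        term j with ℕ.<-≤-connex (toℕ j) (toℕ k)
        ... | inj₁ j<k = trans (cong (a j *F_) (before-pivot j j<k p p≤)) (R.zeroʳ _)
        ... | inj₂ k≤j = trans (cong (_*F lookup (u j) p) (a-zero j k≤j)) (R.zeroˡ _)

      v-pivot : lookup v (piv k) ≢ 0F
      v-pivot eq = *F-nonzero ck≢0 (proj₁ (pivot k)) (begin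
        c k *F lookup (u k) (piv k)    ≡⟨ lookup-lincomb-single c u (piv k) k term ⟨
        lookup (lincomb c u) (piv k)   ≡⟨ cong (λ w → lookup w (piv k)) v≡ ⟨
        lookup v (piv k)               ≡⟨ eq ⟩
        0F                             ∎)
        where
        open ≡-Reasoning
        term : ∀ j → j ≢ k → c j *F lookup (u j) (piv k) ≡ 0F
        term j j≢k with Fin.<-cmp j k
        ... | tri< j<k _ _ = trans (cong (c j *F_) (before-pivot j j<k (piv k) ℕ.≤-refl)) (R.zeroʳ _)
        ... | tri≈ _ j≡k _ = contradiction j≡k j≢k
        ... | tri> _ _ k<j = trans (cong (_*F lookup (u j) (piv k)) (c-zero j k<j)) (R.zeroˡ _)

      v∉U_e : toℕ k ≡ e → ¬ InU u e v
      v∉U_e k≡e (a , a-zero , v≡a) = v-pivot (trans (cong (λ w → lookup w (piv k)) v≡a)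
        (vanishing a (λ j k≤j → a-zero j (subst (_≤ toℕ j) k≡e k≤j)) (piv k) ℕ.≤-refl))

      x≮v : ¬ x <lex v
      x≮v x<v = <lex-irrefl x (<lex-trans x v x x<v v<x)

      absurd : ⊥
      -- For e < k, `x` vanishes up to and including the pivot of row `k`, so `x` is below `v`. For
      -- e = k, `v` itself lies in the set of which `x` is the minimum.
      absurd with ℕ.m≤n⇒m<n∨m≡n e≤k
      ... | inj₁ e<k = x≮v (zeros⇒<lex x v (piv k) (λ p p≤ →
        trans (cong (λ w → lookup w p) x≡)
              (vanishing d (λ j k≤j → d-zero j (ℕ.≤-trans e<k k≤j)) p p≤)) v-pivot)
      ... | inj₂ e≡k with x-min v
        ((c , (λ j e<j → c-zero j (subst (ℕ._< toℕ j) e≡k e<j)) , v≡) , v∉U_e (sym e≡k))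
      ... | inj₁ refl = <lex-irrefl v v<x
      ... | inj₂ x<v = x≮v x<v

    -- The index of the order is at least 1 and is matched as `suc e`, so `same-e` identifies the
    -- layers just below it. As `x` is below `y`, `below-min⇒InU` confines to this common layer the
    -- vectors of `U` below `x` and the vectors of `V` up to and including `x`.
    Preceq⇒≺ : ∀ r U V → Preceq r U V → ¬ U ≐ V → U ≺ V
    Preceq⇒≺ r U V (inj₁ U≐V) U≢V = contradiction U≐V U≢V
    Preceq⇒≺ r U V (inj₂ (u , w , genU , genV , suc e , _ , _ , same , _ , x , y , x-min , y-min , x<y)) _ =
      x , InU⇒∈U (proj₁ (proj₁ x-min)) , x∉V , agree
      where
      InU⇒∈U : ∀ {i v} → InU u i v → v ∈ₛ U
      InU⇒∈U (c , _ , v≡) = subst (_∈ₛ U) (sym v≡) (lincomb-∈ U c u (proj₁ genU))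

      InV⇒∈V : ∀ {i v} → InU w i v → v ∈ₛ V
      InV⇒∈V (c , _ , v≡) = subst (_∈ₛ V) (sym v≡) (lincomb-∈ V c w (proj₁ genV))

      same-e = same e ℕ.≤-refl

      x∉V : ¬ x ∈ₛ V
      x∉V x∈V = proj₂ (proj₁ x-min)
        (proj₂ (same-e x) (below-min⇒InU V w e y x genV y-min x∈V x<y))

      agree : ∀ v → v <lex x → mem U v ≡ mem V v
      agree v v<x = Bool.⇔→≡ (mk⇔
        (λ v∈U → InV⇒∈V (proj₁ (same-e v) (below-min⇒InU U u e x v genU x-min v∈U v<x)))
        (λ v∈V → InU⇒∈U (proj₂ (same-e v)
          (below-min⇒InU V w e y v genV y-min v∈V (<lex-trans v x y v<x x<y)))))

  -- Chains of one-dimensional extensions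

  -- The index is the codimension of `A` in `B`, so rank and dimension can be compared by induction
  -- on the adjoined vectors. `done` asks for equal membership only, not for equal records.
  data Chain : Subspace → Subspace → ℕ → Set where
    done : ∀ {A B} → A ≐ B → Chain A B 0
    step : ∀ {A B m} b → b ∈ₛ B → ¬ b ∈ₛ A → Chain (adjoin A b) B m → Chain A B (suc m)

  -- Every adjoined vector raises the dimension, which is at most `n`; the invariant `n ≤ k + fuel`
  -- therefore prevents `fuel` from running out early.
  ⊆⇒Chain : ∀ A B {k} → HasDim A k → A ⊆ₛ B → ∃ (Chain A B)
  ⊆⇒Chain A B dimA A⊆B = go n A (ℕ.m≤n+m n _) dimA A⊆B
    where
    go : ∀ fuel A {k} → n ≤ k ℕ.+ fuel → HasDim A k → A ⊆ₛ B → ∃ (Chain A B)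
    go fuel A n≤ dimA A⊆B with findLeastLex (λ v → (v ∈? B) ×-dec ¬? (v ∈? A))
    go fuel A n≤ dimA A⊆B | inj₁ none = 0 , done (⊆-antisym A B A⊆B λ v v∈B →
      decidable-stable (v ∈? A) (λ v∉A → none v (v∈B , v∉A)))
    go zero A {k} n≤ dimA A⊆B | inj₂ (b , (b∈B , b∉A) , _) =
      contradiction (ℕ.≤-trans (HasDim⇒≤n (adjoin A b) (HasDim-adjoin A b b∉A dimA)) (subst (n ≤_) (ℕ.+-identityʳ k) n≤))
                    ℕ.1+n≰n
    go (suc fuel) A {k} n≤ dimA A⊆B | inj₂ (b , (b∈B , b∉A) , _)
      with go fuel (adjoin A b) (subst (n ≤_) (ℕ.+-suc k fuel) n≤)
              (HasDim-adjoin A b b∉A dimA) (adjoin-⊆ A B b A⊆B b∈B)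
    ... | m , chain = suc m , step b b∈B b∉A chain

  HasDim-Chain : ∀ {A B m k} → Chain A B m → HasDim A k → HasDim B (m ℕ.+ k)
  HasDim-Chain {A} {B} (done A≐B) dimA = HasDim-resp A B A≐B dimA
  HasDim-Chain {A} {B} {suc m} {k} (step b _ b∉A chain) dimA =
    subst (HasDim B) (ℕ.+-suc m k) (HasDim-Chain chain (HasDim-adjoin A b b∉A dimA))

  dimension : ∀ A → ∃ (HasDim A)
  dimension A with ⊆⇒Chain 0ₛ A HasDim-0 (0⊆ A)
  ... | m , chain = m ℕ.+ 0 , HasDim-Chain chain HasDim-0

  ⊆∧HasDim⇒≐ : ∀ A B {k} → A ⊆ₛ B → HasDim A k → HasDim B k → A ≐ B
  ⊆∧HasDim⇒≐ A B {k} A⊆B dimA dimB with ⊆⇒Chain A B dimA A⊆B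
  ... | _ , done A≐B = A≐B
  ... | suc m , chain@(step _ _ _ _) = contradiction
    (HasDim-unique B (HasDim-Chain chain dimA) dimB) (ℕ.<⇒≢ (s≤s (ℕ.m≤n+m k m)) ∘ sym)

  -- An enumeration of the subspaces of each dimension

  vectors : ∀ m → List (Vec (Fin q) m)
  vectors zero = [] ∷ []
  vectors (suc m) = List.cartesianProductWith _∷_ (List.allFin q) (vectors m)

  ∈-vectors : ∀ {m} (v : Vec (Fin q) m) → v ∈ vectors m
  ∈-vectors [] = here refl
  ∈-vectors (a ∷ v) = ∈-cartesianProductWith⁺ _∷_ (∈-allFin a) (∈-vectors v)

  -- Arbitrary vectors are adjoined, so repetitions and smaller dimensions occur too. What matters
  -- is that each `k`-dimensional subspace is listed up to `≐`.
  spans : ℕ → List Subspace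
  spans zero = 0ₛ ∷ []
  spans (suc k) = List.cartesianProductWith adjoin (spans k) (vectors n)

  -- `A′` is a listed copy of `A`; adjoining the chain's own vectors to it ends at a listed copy of
  -- `B`.
  Chain⇒∈-spans : ∀ {A B m k} A′ → A′ ≐ A → A′ ∈ spans k → Chain A B m →
    ∃ λ B′ → B′ ≐ B × B′ ∈ spans (m ℕ.+ k)
  Chain⇒∈-spans A′ A′≐A A′∈ (done A≐B) = A′ , (λ v → trans (A′≐A v) (A≐B v)) , A′∈
  Chain⇒∈-spans {A} {B} {suc m} {k} A′ A′≐A A′∈ (step b _ _ chain) =
    subst (λ i → ∃ λ B′ → B′ ≐ B × B′ ∈ spans i) (ℕ.+-suc m k)
      (Chain⇒∈-spans {k = suc k} (adjoin A′ b) (adjoin-cong A′ A b A′≐A)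
        (∈-cartesianProductWith⁺ adjoin A′∈ (∈-vectors b)) chain)

  HasDim⇒∈-spans : ∀ A {k} → HasDim A k → ∃ λ A′ → A′ ≐ A × A′ ∈ spans k
  HasDim⇒∈-spans A dimA with ⊆⇒Chain 0ₛ A HasDim-0 (0⊆ A)
  ... | m , chain with Chain⇒∈-spans 0ₛ (λ _ → refl) (here refl) chain
  ... | A′ , A′≐A , A′∈ = A′ , A′≐A
    , subst (λ i → A′ ∈ spans i) (HasDim-unique A (HasDim-Chain chain HasDim-0) dimA) A′∈

  -- Strictly sorted lists of subspaces

  insert : Subspace → List Subspace → List Subspace
  insert U [] = U ∷ []
  insert U (V ∷ Vs) with ≺-connex U V
  ... | inj₁ _ = U ∷ V ∷ Vs
  ... | inj₂ (inj₁ _) = V ∷ Vs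
  ... | inj₂ (inj₂ _) = V ∷ insert U Vs

  insert-All : ∀ {P : Subspace → Set} U Vs → P U → All P Vs → All P (insert U Vs)
  insert-All U [] pU [] = pU ∷ []
  insert-All U (V ∷ Vs) pU (pV ∷ pVs) with ≺-connex U V
  ... | inj₁ _ = pU ∷ pV ∷ pVs
  ... | inj₂ (inj₁ _) = pV ∷ pVs
  ... | inj₂ (inj₂ _) = pV ∷ insert-All U Vs pU pVs

  insert-sorted : ∀ U Vs → AllPairs _≺_ Vs → AllPairs _≺_ (insert U Vs)
  insert-sorted U [] [] = [] ∷ []
  insert-sorted U (V ∷ Vs) (V≺ ∷ sorted) with ≺-connex U V
  ... | inj₁ U≺V = (U≺V ∷ All.map (λ {W} → ≺-trans U V W U≺V) V≺) ∷ V≺ ∷ sorted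
  ... | inj₂ (inj₁ _) = V≺ ∷ sorted
  ... | inj₂ (inj₂ V≺U) = insert-All U Vs V≺U V≺ ∷ insert-sorted U Vs sorted

  insert-∈ : ∀ U Vs → Any (_≐ U) (insert U Vs)
  insert-∈ U [] = here λ _ → refl
  insert-∈ U (V ∷ Vs) with ≺-connex U V
  ... | inj₁ _ = here λ _ → refl
  ... | inj₂ (inj₁ U≐V) = here (≐-sym U V U≐V)
  ... | inj₂ (inj₂ _) = there (insert-∈ U Vs)

  insert-keeps : ∀ {P : Subspace → Set} U Vs → Any P Vs → Any P (insert U Vs)
  insert-keeps U (V ∷ Vs) p with ≺-connex U V
  ... | inj₁ _ = there p
  ... | inj₂ (inj₁ _) = p
  insert-keeps U (V ∷ Vs) (here p) | inj₂ (inj₂ _) = here p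
  insert-keeps U (V ∷ Vs) (there p) | inj₂ (inj₂ _) = there (insert-keeps U Vs p)

  -- Completeness holds up to `≐` because `insert` discards a subspace that equals a listed one, as
  -- strict sorting demands.
  sortedFilter : ∀ {P : Subspace → Set} → Decidable P → (Us : List Subspace) →
    ∃ λ Vs → All P Vs × AllPairs _≺_ Vs × (∀ U → U ∈ Us → P U → Any (_≐ U) Vs)
  sortedFilter P? [] = [] , [] , [] , λ _ ()
  sortedFilter P? (U ∷ Us) with P? U | sortedFilter P? Us
  ... | yes pU | Vs , allP , sorted , complete = insert U Vs , insert-All U Vs pU allP , insert-sorted U Vs sorted
    , λ { W (here refl) _ → insert-∈ U Vs ; W (there W∈) pW → insert-keeps U Vs (complete W W∈ pW) }
  ... | no ¬pU | Vs , allP , sorted , complete = Vs , allP , sorted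
    , λ { W (here refl) pW → contradiction pW ¬pU ; W (there W∈) pW → complete W W∈ pW }

  -- Rank and independence in a q-matroid

  module _ (M : QMatroid) where
    open QMatroid M

    -- Diminishing returns: `b` raises the rank of the larger space `C` by no more than that of `A`.
    -- This is submodularity for `C` and `adjoin A b`.
    ρ-adjoin-submod : ∀ A C b → A ⊆ₛ C → ρ (adjoin C b) ℕ.+ ρ A ≤ ρ C ℕ.+ ρ (adjoin A b)
    ρ-adjoin-submod A C b A⊆C = ℕ.≤-trans
      (ℕ.+-monoʳ-≤ (ρ (adjoin C b)) (ρ-mono A I λ v v∈A → ∈-∩⁺ C (adjoin A b) (A⊆C v v∈A) (⊆-adjoin A b v v∈A)))
      (ρ-submod C (adjoin A b) (adjoin C b) I (adjoin-isSum A C b A⊆C) (∩-isIntersection C (adjoin A b)))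
      where
      I = C ∩ₛ adjoin A b

    -- Diminishing returns over `0ₛ`: the gain is at most the rank of the line through `b`.
    ρ-adjoin-≤ : ∀ A b → ¬ b ∈ₛ A → ρ (adjoin A b) ≤ suc (ρ A)
    ρ-adjoin-≤ A b b∉A = begin
      ρ (adjoin A b)              ≤⟨ ℕ.m≤m+n _ _ ⟩
      ρ (adjoin A b) ℕ.+ ρ 0ₛ     ≤⟨ ρ-adjoin-submod 0ₛ A b (0⊆ A) ⟩
      ρ A ℕ.+ ρ (adjoin 0ₛ b)     ≤⟨ ℕ.+-monoʳ-≤ (ρ A) (ρ-≤dim _ 1 (HasDim-adjoin 0ₛ b (b∉A ∘ 0⊆ A b) HasDim-0)) ⟩
      ρ A ℕ.+ 1                   ≡⟨ ℕ.+-comm (ρ A) 1 ⟩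
      suc (ρ A)                   ∎
      where open ℕ.≤-Reasoning

    ρ-Chain : ∀ {A B m} → Chain A B m → ρ B ≤ m ℕ.+ ρ A
    ρ-Chain {A} {B} (done A≐B) = ℕ.≤-reflexive (sym (ρ-resp A B A≐B))
    ρ-Chain {A} {B} {suc m} (step b _ b∉A chain) = begin
      ρ B                       ≤⟨ ρ-Chain chain ⟩
      m ℕ.+ ρ (adjoin A b)      ≤⟨ ℕ.+-monoʳ-≤ m (ρ-adjoin-≤ A b b∉A) ⟩
      m ℕ.+ suc (ρ A)           ≡⟨ ℕ.+-suc m (ρ A) ⟩
      suc m ℕ.+ ρ A             ∎
      where open ℕ.≤-Reasoning

    -- From `A` to `B` the rank grows by at most the codimension. Since `B` has full rank,
    -- cancelling the codimension leaves full rank for `A`.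
    Independent-⊆ : IsQComplex (Δ M)
    Independent-⊆ A B A⊆B indB with dimension A
    ... | k , dimA with ⊆⇒Chain A B dimA A⊆B
    ... | m , chain = subst (HasDim A)
      (ℕ.≤-antisym (ℕ.+-cancelˡ-≤ m k (ρ A) (begin
        m ℕ.+ k     ≡⟨ HasDim-unique B (HasDim-Chain chain dimA) indB ⟩
        ρ B         ≤⟨ ρ-Chain chain ⟩
        m ℕ.+ ρ A   ∎)) (ρ-≤dim A k dimA)) dimA
      where open ℕ.≤-Reasoning

    -- `C` climbs from `A` to `B`. A vector that does not raise the rank of `A` cannot raise that of
    -- `C` either, by diminishing returns.
    ρ-closure : ∀ A B {C m} → (∀ b → b ∈ₛ B → ρ (adjoin A b) ≤ ρ A) →
      A ⊆ₛ C → ρ C ≤ ρ A → Chain C B m → ρ B ≤ ρ A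
    ρ-closure A B {C} flat A⊆C ρC≤ (done C≐B) = subst (_≤ ρ A) (ρ-resp C B C≐B) ρC≤
    ρ-closure A B {C} flat A⊆C ρC≤ (step b b∈B _ chain) =
      ρ-closure A B flat (λ v v∈A → ⊆-adjoin C b v (A⊆C v v∈A))
        (ℕ.+-cancelʳ-≤ (ρ A) _ _ (ℕ.≤-trans (ρ-adjoin-submod A C b A⊆C) (ℕ.+-mono-≤ ρC≤ (flat b b∈B))))
        chain

    -- The rank grows by at least one and the dimension by exactly one, so the two stay equal.
    Independent-adjoin : ∀ A b → Independent M A → ρ A ℕ.< ρ (adjoin A b) →
      ρ (adjoin A b) ≡ suc (ρ A) × Independent M (adjoin A b)
    Independent-adjoin A b indA lt = ρ⁺ , subst (HasDim (adjoin A b)) (sym ρ⁺) dim⁺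
      where
      b∉A : ¬ b ∈ₛ A
      b∉A b∈A = ℕ.<⇒≱ lt (ρ-mono (adjoin A b) A (adjoin-⊆ A A b (λ _ z → z) b∈A))

      dim⁺ : HasDim (adjoin A b) (suc (ρ A))
      dim⁺ = HasDim-adjoin A b b∉A indA

      ρ⁺ : ρ (adjoin A b) ≡ suc (ρ A)
      ρ⁺ = ℕ.≤-antisym (ρ-≤dim _ _ dim⁺) lt

    -- A basis of `B` through `A`, with equality of ranks standing in for inclusion-maximality.
    MaximalIndependent : Subspace → Subspace → Set
    MaximalIndependent A B = ∃ λ W → Independent M W × A ⊆ₛ W × W ⊆ₛ B × ρ W ≡ ρ B

    -- Greedy: adjoin vectors of `B` that raise the rank until none is left; then `ρ-closure` gives
    -- equal ranks. The rank of an independent space is its dimension, so `n` bounds the number of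
    -- rounds.
    augment : ∀ A B → Independent M A → A ⊆ₛ B → MaximalIndependent A B
    augment A B = go n A (ℕ.m≤n+m n (ρ A))
      where
      raising? : ∀ A → Decidable (λ b → b ∈ₛ B × ρ A ℕ.< ρ (adjoin A b))
      raising? A b = (b ∈? B) ×-dec (ρ A ℕ.<? ρ (adjoin A b))

      weaken : ∀ A b → MaximalIndependent (adjoin A b) B → MaximalIndependent A B
      weaken A b (W , indW , A⁺⊆W , rest) = W , indW , (λ v v∈A → A⁺⊆W v (⊆-adjoin A b v v∈A)) , rest

      go : ∀ fuel A → n ≤ ρ A ℕ.+ fuel → Independent M A → A ⊆ₛ B → MaximalIndependent A B
      extend : ∀ fuel A b → n ≤ ρ A ℕ.+ fuel → Independent M A → A ⊆ₛ B → b ∈ₛ B →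
        ρ (adjoin A b) ≡ suc (ρ A) → Independent M (adjoin A b) → MaximalIndependent A B

      go fuel A n≤ indA A⊆B with findLeastLex (raising? A)
      ... | inj₁ none = A , indA , (λ _ z → z) , A⊆B
        , ℕ.≤-antisym (ρ-mono A B A⊆B)
            (ρ-closure A B {A} (λ b b∈B → ℕ.≮⇒≥ λ lt → none b (b∈B , lt)) (λ _ z → z) ℕ.≤-refl
              (proj₂ (⊆⇒Chain A B indA A⊆B)))
      ... | inj₂ (b , (b∈B , lt) , _) =
        extend fuel A b n≤ indA A⊆B b∈B (proj₁ (Independent-adjoin A b indA lt)) (proj₂ (Independent-adjoin A b indA lt))

      extend zero A b n≤ indA A⊆B b∈B ρ⁺ ind⁺ = contradiction
        (ℕ.≤-trans (subst (_≤ n) ρ⁺ (HasDim⇒≤n (adjoin A b) ind⁺)) (subst (n ≤_) (ℕ.+-identityʳ (ρ A)) n≤))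
        ℕ.1+n≰n
      extend (suc fuel) A b n≤ indA A⊆B b∈B ρ⁺ ind⁺ = weaken A b (go fuel (adjoin A b)
        (subst (n ≤_) (trans (ℕ.+-suc (ρ A) fuel) (cong (ℕ._+ fuel) (sym ρ⁺))) n≤)
        ind⁺ (adjoin-⊆ A B b A⊆B b∈B))

    -- Facets

    -- Extend `F` to an independent space of full rank; maximality forces the extension to be `F`.
    facet⇒ρ≡rank : ∀ F → IsFacet (Δ M) F → ρ F ≡ rank M
    facet⇒ρ≡rank F (indF , maximal) with augment F Eₛ indF (λ _ _ → refl)
    ... | W , indW , F⊆W , _ , ρW = trans (sym (ρ-resp W F (maximal W indW F⊆W))) ρW

    facet⇒HasDim : ∀ F → IsFacet (Δ M) F → HasDim F (rank M)
    facet⇒HasDim F facet@(indF , _) = subst (HasDim F) (facet⇒ρ≡rank F facet) indF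

    -- An independent `G` containing `F` has its rank, hence its dimension, squeezed between that of
    -- `F` and `rank M`.
    ρ≡rank⇒facet : ∀ F → Independent M F → ρ F ≡ rank M → IsFacet (Δ M) F
    ρ≡rank⇒facet F indF ρF = indF , λ G indG F⊆G →
      ≐-sym F G (⊆∧HasDim⇒≐ F G F⊆G indF (subst (HasDim G)
        (ℕ.≤-antisym (subst (ρ G ≤_) (sym ρF) (ρ-mono G Eₛ (λ _ _ → refl))) (ρ-mono F G F⊆G)) indG))

    -- Maximality over all independent spaces is replaced by two numerical tests: dimension against
    -- `ρ F`, and `ρ F` against `rank M`.
    facet? : Decidable (IsFacet (Δ M))
    facet? F with dimension F
    ... | k , dimF with k ℕ.≟ ρ F | ρ F ℕ.≟ rank M
    ... | yes refl | yes ρF = yes (ρ≡rank⇒facet F dimF ρF)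
    ... | no k≢ρ | _ = no λ (indF , _) → k≢ρ (HasDim-unique F dimF indF)
    ... | yes _ | no ρ≢r = no λ facet → ρ≢r (facet⇒ρ≡rank F facet)

    pure : Pure (Δ M)
    pure = rank M , facet⇒HasDim

    -- Exchange between two bases

    Exchange : Subspace → Subspace → Set
    -- By connexity the two negations say that `W` precedes `V`; in this form they directly exclude
    -- two of the three cases when indices are compared later.
    Exchange U V = ∃ λ W → IsFacet (Δ M) W × U ∩ₛ V ⊆ₛ W × ¬ W ≐ V × ¬ V ≺ W
      × ∃ λ k → HasDim V (suc k) × HasDim (W ∩ₛ V) k

    -- `W` is `H` plus the span of `x`, with `x` outside `H`; as `W` and `V` have the same
    -- dimension, `H` is a hyperplane of `V`.
    augmented⇒Exchange : ∀ U V → IsFacet (Δ M) V → ((x , _) : U ≺ V) →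
      MaximalIndependent (adjoin (U ∩ₛ V) x) (adjoin V x) → Exchange U V
    augmented⇒Exchange U V facetV (x , x∈U , x∉V , agree) (W , indW , A⊆W , W⊆B , ρW≡ρB) =
      W , facetW , U∩V⊆W , W≢V , V⊀W , proj₁ (dimension H) , dimV (dimension H) , proj₂ (dimension H)
      where
      H = W ∩ₛ V

      x∈W : x ∈ₛ W
      x∈W = A⊆W x (∈-adjoin (U ∩ₛ V) x)

      U∩V⊆W : U ∩ₛ V ⊆ₛ W
      U∩V⊆W v v∈ = A⊆W v (⊆-adjoin (U ∩ₛ V) x v v∈)

      facetW : IsFacet (Δ M) W
      facetW = ρ≡rank⇒facet W indW (ℕ.≤-antisym (ρ-mono W Eₛ (λ _ _ → refl)) (begin
        rank M          ≡⟨ facet⇒ρ≡rank V facetV ⟨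
        ρ V             ≤⟨ ρ-mono V (adjoin V x) (⊆-adjoin V x) ⟩
        ρ (adjoin V x)  ≡⟨ ρW≡ρB ⟨
        ρ W             ∎))
        where open ℕ.≤-Reasoning

      W≢V : ¬ W ≐ V
      W≢V W≐V = x∉V (≐⇒⊆ W V W≐V x x∈W)

      V⊀W : ¬ V ≺ W
      -- A witness `z` above `x` would force `V` and `W` to agree at `x`; one below `x` lies in `U`
      -- as well, hence in `W`.
      V⊀W (z , z∈V , z∉W , agree′) with <lex-connex x z
      ... | inj₁ x<z = x∉V (trans (agree′ x x<z) x∈W)
      ... | inj₂ (inj₁ refl) = x∉V z∈V
      ... | inj₂ (inj₂ z<x) = z∉W (U∩V⊆W z (∈-∩⁺ U V (trans (agree z z<x) z∈V) z∈V))

      W⊆H+x : W ⊆ₛ adjoin H x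
      -- The translate of `w` that lies in `V` also lies in `W`, because `x` does.
      W⊆H+x w w∈W with ∈-adjoin⁻ V x (W⊆B w w∈W)
      ... | c , w+cx∈V = ∈-adjoin⁺ H x c
        (∈-∩⁺ W V (+-closed W _ _ w∈W (·-closed W c x x∈W)) w+cx∈V)

      dimV : ((k , _) : ∃ (HasDim H)) → HasDim V (suc k)
      dimV (k , dimH) = subst (HasDim V) (HasDim-unique W (facet⇒HasDim W facetW)
        (HasDim-resp (adjoin H x) W
          (⊆-antisym (adjoin H x) W (adjoin-⊆ H W x (∩⊆ˡ W V) x∈W) W⊆H+x)
          (HasDim-adjoin H x (x∉V ∘ ∩⊆ʳ W V x) dimH)))
        (facet⇒HasDim V facetV)

    exchange : ∀ U V → IsFacet (Δ M) U → IsFacet (Δ M) V → U ≺ V → Exchange U V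
    exchange U V facetU facetV U≺V@(x , x∈U , _) = augmented⇒Exchange U V facetV U≺V
      (augment A (adjoin V x)
        (Independent-⊆ A U (adjoin-⊆ (U ∩ₛ V) U x (∩⊆ˡ U V) x∈U) (proj₁ facetU))
        (adjoin-mono (U ∩ₛ V) V x (∩⊆ʳ U V)))
      where
      A = adjoin (U ∩ₛ V) x

    -- From a sorted list of bases to a shelling

    sorted⇒shelling : ∀ t (F : Fin t → Subspace) → (∀ i → IsFacet (Δ M) (F i)) →
      (∀ G → IsFacet (Δ M) G → ∃[ i ] (F i ≐ G)) → (∀ i j → i < j → F i ≺ F j) →
      IsShelling (Δ M) t F
    sorted⇒shelling t F facets complete sorted = (facets , complete , injective) , shellingStep
      where
      injective : ∀ i j → F i ≐ F j → i ≡ j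
      injective i j Fi≐Fj with Fin.<-cmp i j
      ... | tri< i<j _ _ = contradiction (sorted i j i<j) (≺-irrefl (F i) (F j) Fi≐Fj)
      ... | tri≈ _ i≡j _ = i≡j
      ... | tri> _ _ j<i = contradiction (sorted j i j<i) (≺-irrefl (F j) (F i) (≐-sym (F i) (F j) Fi≐Fj))

      -- `G` is the generator responsible for index `i`: it absorbs everything common to `F i` and
      -- `F j`, and lies in an earlier facet `F l`.
      Neighbour : Fin t → Fin t → Set
      Neighbour i j = ∃ λ G → F i ∩ₛ F j ⊆ₛ G × G ⊆ₛ F j
        × (∃ λ k → HasDim (F j) (suc k) × HasDim G k) × ∃ λ l → l < j × G ⊆ₛ F l

      exchange⇒Neighbour : ∀ i j → Exchange (F i) (F j) → Neighbour i j
      exchange⇒Neighbour i j (W , facetW , ⊆W , W≢Fj , Fj⊀W , dims) = W ∩ₛ F j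
        , (λ v v∈ → ∈-∩⁺ W (F j) (⊆W v v∈) (∩⊆ʳ (F i) (F j) v v∈)) , ∩⊆ʳ W (F j) , dims
        , l , l<j , λ v v∈ → trans (Fl≐W v) (∩⊆ˡ W (F j) v v∈)
        where
        l = proj₁ (complete W facetW)

        Fl≐W : F l ≐ W
        Fl≐W = proj₂ (complete W facetW)

        l<j : l < j
        l<j with Fin.<-cmp l j
        ... | tri< l<j _ _ = l<j
        ... | tri≈ _ l≡j _ = contradiction (λ v → trans (sym (Fl≐W v)) (cong (λ i → mem (F i) v) l≡j)) W≢Fj
        -- Here `F j` precedes `F l` and hence `W`, which has the same members as `F l`; the
        -- exchange excludes this.
        ... | tri> _ _ j<l with sorted j l j<l
        ... | x , x∈Fj , x∉Fl , agree = contradiction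
          (x , x∈Fj , (λ x∈W → x∉Fl (trans (Fl≐W x) x∈W)) , λ v v<x → trans (agree v v<x) (Fl≐W v)) Fj⊀W

      neighbour : ∀ i j → i < j → Neighbour i j
      neighbour i j i<j = exchange⇒Neighbour i j
        (exchange (F i) (F j) (facets i) (facets j) (sorted i j i<j))

      neighbours⇒step : ∀ j → 1 ≤ toℕ j → (∀ i → i < j → Neighbour i j) → ShellingStep t F j
      -- One generator for each earlier index, repetitions allowed. With `m` equal to `toℕ j′`, the
      -- index type `Fin (suc m)` is `Fin (toℕ j)`, nonempty because `j` is a successor.
      neighbours⇒step j@(suc j′) _ nb = toℕ j′ , (λ g → proj₁ (N g))
        , (λ g → proj₁ (proj₂ (proj₂ (N g))) , proj₁ (proj₂ (proj₂ (proj₂ (N g)))))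
        , λ A → below A , above A
        where
        prev : Fin (toℕ j) → Fin t
        prev g = inject {i = j} g

        prev-fromℕ< : ∀ i (i<j : i < j) → prev (fromℕ< i<j) ≡ i
        prev-fromℕ< i i<j = Fin.toℕ-injective
          (trans (Fin.toℕ-inject {i = j} (fromℕ< i<j)) (Fin.toℕ-fromℕ< i<j))

        N : ∀ g → Neighbour (prev g) j
        N g = nb (prev g) (subst (ℕ._< toℕ j) (sym (Fin.toℕ-inject {i = j} g)) (Fin.toℕ<n g))

        below : ∀ A → A ⊆ₛ F j × ∃[ i ] (toℕ i ℕ.< toℕ j × A ⊆ₛ F i) → ∃[ g ] (A ⊆ₛ proj₁ (N g))
        below A (A⊆Fj , i , i<j , A⊆Fi) = g , λ v v∈A → proj₁ (proj₂ (N g)) v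
          (∈-∩⁺ (F (prev g)) (F j)
            (subst (λ l → v ∈ₛ F l) (sym (prev-fromℕ< i i<j)) (A⊆Fi v v∈A)) (A⊆Fj v v∈A))
          where g = fromℕ< i<j

        above : ∀ A → ∃[ g ] (A ⊆ₛ proj₁ (N g)) → A ⊆ₛ F j × ∃[ i ] (toℕ i ℕ.< toℕ j × A ⊆ₛ F i)
        above A (g , A⊆G) with N g
        ... | G , _ , G⊆Fj , _ , l , l<j , G⊆Fl =
          (λ v v∈A → G⊆Fj v (A⊆G v v∈A)) , l , l<j , λ v v∈A → G⊆Fl v (A⊆G v v∈A)

      shellingStep : ∀ j → 1 ≤ toℕ j → ShellingStep t F j
      shellingStep j 1≤j = neighbours⇒step j 1≤j λ i → neighbour i j

    -- All facets have dimension `rank M`, so filtering and sorting the finite list `spans (rank M)`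
    -- yields an ordering of them.
    shellable : Shellable (Δ M)
    shellable with sortedFilter facet? (spans (rank M))
    ... | Fs , facets , sorted , complete = pure , List.length Fs , List.lookup Fs
      , sorted⇒shelling _ (List.lookup Fs) (λ i → All.lookup facets (∈-lookup i)) found (lookup-sorted sorted)
      where
      lookup-sorted : ∀ {Us} → AllPairs _≺_ Us → ∀ i j → i < j → List.lookup Us i ≺ List.lookup Us j
      lookup-sorted (U≺ ∷ _) zero (suc j) _ = All.lookup U≺ (∈-lookup j)
      lookup-sorted (_ ∷ rest) (suc i) (suc j) (s≤s i<j) = lookup-sorted rest i j i<j

      found : ∀ G → IsFacet (Δ M) G → ∃[ i ] (List.lookup Fs i ≐ G)
      found G facetG@(indG , maximal) with HasDim⇒∈-spans G (facet⇒HasDim G facetG)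
      ... | G′ , G′≐G , G′∈ = Any.index any , λ v → trans (Any.lookup-index any v) (G′≐G v)
        where
        -- The filter tests the listed copy `G′` rather than `G`, so the facet property has to be
        -- transferred.
        facetG′ : IsFacet (Δ M) G′
        facetG′ = ρ≡rank⇒facet G′
          (subst (HasDim G′) (sym (ρ-resp G′ G G′≐G)) (HasDim-resp G G′ (≐-sym G′ G G′≐G) indG))
          (trans (ρ-resp G′ G G′≐G) (facet⇒ρ≡rank G facetG))
        any : Any (_≐ G′) Fs
        any = complete G′ G′∈ facetG′

theorem4p4 : (q : ℕ) → IsPrimePower q →
    (K : FiniteField q) → OrderedAsRequired K →
    (n : ℕ) → (M : LinAlg.QMatroid K n) →
    let open LinAlg K n in
    Shellable (Δ M) ×
    ((t : ℕ) (F : Fin t → Subspace) →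
    (∀ i → IsFacet (Δ M) (F i)) →
    (∀ G → IsFacet (Δ M) G → ∃[ i ] (F i ≐ G)) →
    (∀ i j → i < j → Preceq (rank M) (F i) (F j) × ¬ (F i ≐ F j)) →
    IsShelling (Δ M) t F)
theorem4p4 q _ K (0F-least , _) n M =
  shellable K n M , λ t F facets complete sorted →
    sorted⇒shelling K n M t F facets complete λ i j i<j →
      EchelonOrder.Preceq⇒≺ K n 0F-least (LinAlg.rank K n M) (F i) (F j)
        (proj₁ (sorted i j i<j)) (proj₂ (sorted i j i<j))
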